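{- Let $\mathfrak{A}_i=(S_i,\mathcal{L}_i,\parallel_i)$, $i=1,2$, be affine spaces and $\mathfrak{A}'_i=(S_i,\mathcal{L}_i)$ their point-line reducts. Let $\mathfrak{A}=\mathfrak{A}_1\otimes\mathfrak{A}_2$ be their Segre product, with parallelism $\parallel$ defined by: for lines $L=a[i/l]$, $K=b[j/k]$ ($l\in\mathcal{L}_i$, $k\in\mathcal{L}_j$), $L\parallel K$ iff $i=j$ and $l\parallel_i k$. Then $\parallel$ is definable by a first-order formula in terms of the point-line incidence of $\mathfrak{A}'_1\otimes\mathfrak{A}'_2$ (i.e. in the language of points, lines and incidence only).
   Context: A partial linear space is a pair $(S,\mathcal{L})$ of points and lines such that every line has at least two points, every point is on a line, two distinct lines share at most one point; it is a linear space if any two points are collinear. A partial affine partial linear space is $(S,\mathcal{L},\parallel)$ with $(S,\mathcal{L})$ a partial linear space and $\parallel$ an equivalence relation on $\mathcal{L}$ such that parallel lines sharing a point coincide; it is an affine partial linear space if moreover for every point $a$ and line $L$ there is a line $K$ with $a\in K\parallel L$. It satisfies the Tamaschke Bedingung if for any two lines $L_1,L_2$ through a point $p$ and lines $K_1,K_2$ not through $p$ with $K_1$ meeting $L_1$ and $L_2$, $K_2$ meeting $L_1$, and $K_1\parallel K_2$, the line $K_2$ meets $L_2$; it satisfies the parallelogram completion condition if for $L_1\parallel L_2$, $K_1\parallel K_2$ with $L_1,L_2$ meeting $K_1$ and $L_1$ meeting $K_2$, also $L_2$ meets $K_2$. An affine space is an affine linear space satisfying both conditions. Segre product of two point-line structures: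 points $S_1\times S_2$; for $a\in S_1\times S_2$, $a[i/A]$ is the set of points obtained by replacing the $i$-th coordinate of $a$ by elements of $A\subseteq S_i$; lines are $a[i/l]$ with $l\in\mathcal{L}_i$, $i\in\{1,2\}$.
   Formalization: The formal theorem additionally assumes that neither affine space has both a two-point line and at least five points; without this the claim fails, e.g. for AG(3,2), whose lines are all pairs of points, so that incidence does not determine parallelism. -}

module Defs where

open import Level using (Level; suc)
open import Data.Nat using (ℕ) renaming (suc to 1+)
open import Data.Fin using (Fin)
open import Data.Vec using (Vec; []; _∷_; lookup)
open import Data.Product using (Σ; Σ-syntax; ∃; ∃-syntax; _×_; _,_)
open import Data.Sum using (_⊎_)
open import Data.Empty.Polymorphic using (⊥)
open import Function.Bundles using (_⇔_; _↣_)
open import Relation.Nullary using (¬_)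
open import Relation.Binary.Structures using (IsEquivalence)
open import Relation.Binary.PropositionalEquality using (_≡_; _≢_)

private
  variable
    ℓ : Level

-- Lines are abstract objects related to points by incidence.  In a partial
-- linear space a line is determined by its points, so this agrees with
-- taking lines to be sets of points.
record PointLineStructure ℓ : Set (suc ℓ) where
  infix 4 _∈_
  field
    Point : Set ℓ
    Line  : Set ℓ
    _∈_   : Point → Line → Set ℓ

  Meet : Line → Line → Set ℓ
  Meet L K = ∃[ a ] a ∈ L × a ∈ K

  Collinear : Point → Point → Set ℓ
  Collinear a b = ∃[ L ] a ∈ L × b ∈ L

record IsPartialLinearSpace (𝔐 : PointLineStructure ℓ) : Set ℓ where
  open PointLineStructure 𝔐
  field
    twoPoints    : ∀ L → ∃[ a ] ∃[ b ] a ≢ b × a ∈ L × b ∈ L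
    pointOnLine  : ∀ a → ∃[ L ] a ∈ L
    atMostOneInt : ∀ {L K a b} → L ≢ K →
                   a ∈ L → a ∈ K → b ∈ L → b ∈ K → a ≡ b

record IsLinearSpace (𝔐 : PointLineStructure ℓ) : Set ℓ where
  open PointLineStructure 𝔐
  field
    isPartialLinearSpace : IsPartialLinearSpace 𝔐
    collinear            : ∀ a b → Collinear a b

  open IsPartialLinearSpace isPartialLinearSpace public

record ParallelStructure ℓ : Set (suc ℓ) where
  infix 4 _∥_
  field
    reduct : PointLineStructure ℓ

  open PointLineStructure reduct public

  field
    _∥_ : Line → Line → Set ℓ

record IsPartialAffine (𝔄 : ParallelStructure ℓ) : Set ℓ where
  open ParallelStructure 𝔄
  field
    isPartialLinearSpace : IsPartialLinearSpace reduct
    ∥-isEquivalence      : IsEquivalence _∥_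
    ∥-meet⇒≡             : ∀ {L K} → L ∥ K → Meet L K → L ≡ K

record IsAffinePartialLinear (𝔄 : ParallelStructure ℓ) : Set ℓ where
  open ParallelStructure 𝔄
  field
    isPartialAffine : IsPartialAffine 𝔄
    parallelThrough : ∀ a L → ∃[ K ] a ∈ K × K ∥ L

  open IsPartialAffine isPartialAffine public

module _ (𝔄 : ParallelStructure ℓ) where
  open ParallelStructure 𝔄

  Tamaschke : Set ℓ
  Tamaschke = ∀ {p L₁ L₂ K₁ K₂} →
    p ∈ L₁ → p ∈ L₂ → ¬ (p ∈ K₁) → ¬ (p ∈ K₂) →
    Meet K₁ L₁ → Meet K₁ L₂ → Meet K₂ L₁ → K₁ ∥ K₂ →
    Meet K₂ L₂

  ParallelogramCompletion : Set ℓ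
  ParallelogramCompletion = ∀ {L₁ L₂ K₁ K₂} →
    L₁ ∥ L₂ → K₁ ∥ K₂ →
    Meet L₁ K₁ → Meet L₂ K₁ → Meet L₁ K₂ →
    Meet L₂ K₂

record IsAffineSpace (𝔄 : ParallelStructure ℓ) : Set ℓ where
  field
    isLinearSpace           : IsLinearSpace (ParallelStructure.reduct 𝔄)
    isAffinePartialLinear   : IsAffinePartialLinear 𝔄
    tamaschke               : Tamaschke 𝔄
    parallelogramCompletion : ParallelogramCompletion 𝔄

-- An affine space with a two-point line is an affine space over the field
-- with two elements: all its lines have two points and a finite one has 2ⁿ
-- points.  More than four points therefore means dimension at least three.
-- Then every pair of points is a line, so every permutation of the points
-- preserves incidence although not every one preserves parallelism.
BinaryOfDim≥3 : ParallelStructure ℓ → Set ℓ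
BinaryOfDim≥3 𝔄 =
    (∃[ L ] ∃[ a ] ∃[ b ] (∀ c → c ∈ L → c ≡ a ⊎ c ≡ b))
  × (Fin 5 ↣ Point)
  where open ParallelStructure 𝔄

module _ (𝔐₁ 𝔐₂ : PointLineStructure ℓ) where
  private
    module M₁ = PointLineStructure 𝔐₁
    module M₂ = PointLineStructure 𝔐₂

  -- The set a[1/l] does not depend on the first coordinate of a, nor a[2/l]
  -- on the second, so  line₁ l y  is a[1/l] for every a with second
  -- coordinate y, and  line₂ x l  is a[2/l] for every a with first
  -- coordinate x.  Distinct values thus stand for distinct sets of points
  -- whenever the factors are partial linear spaces.
  data SegreLine : Set ℓ where
    line₁ : M₁.Line → M₂.Point → SegreLine
    line₂ : M₁.Point → M₂.Line → SegreLine

  SegreIncidence : M₁.Point × M₂.Point → SegreLine → Set ℓ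
  SegreIncidence (x , y) (line₁ l b) = x M₁.∈ l × y ≡ b
  SegreIncidence (x , y) (line₂ a l) = x ≡ a × y M₂.∈ l

  infixr 7 _⊗_
  _⊗_ : PointLineStructure ℓ
  _⊗_ = record
    { Point = M₁.Point × M₂.Point
    ; Line  = SegreLine
    ; _∈_   = SegreIncidence
    }

module _ (𝔄₁ 𝔄₂ : ParallelStructure ℓ) where
  private
    module A₁ = ParallelStructure 𝔄₁
    module A₂ = ParallelStructure 𝔄₂

  SegreParallel : (L K : SegreLine A₁.reduct A₂.reduct) → Set ℓ
  SegreParallel (line₁ l _) (line₁ k _) = l A₁.∥ k
  SegreParallel (line₂ _ l) (line₂ _ k) = l A₂.∥ k
  SegreParallel (line₁ _ _) (line₂ _ _) = ⊥
  SegreParallel (line₂ _ _) (line₁ _ _) = ⊥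

-- Two-sorted first-order logic with equality over the single binary symbol
-- of incidence.  Variables are de Bruijn indices, counted separately for
-- each sort:  Formula p l  has free point variables among Fin p and free
-- line variables among Fin l.
data Formula : ℕ → ℕ → Set where
  _∈′_   : ∀ {p l} → Fin p → Fin l → Formula p l
  _≡ᵖ_   : ∀ {p l} → Fin p → Fin p → Formula p l
  _≡ˡ_   : ∀ {p l} → Fin l → Fin l → Formula p l
  ⊥′     : ∀ {p l} → Formula p l
  _∧′_ _∨′_ _⇒′_ : ∀ {p l} → Formula p l → Formula p l → Formula p l
  ∀ᵖ ∃ᵖ  : ∀ {p l} → Formula (1+ p) l → Formula p l
  ∀ˡ ∃ˡ  : ∀ {p l} → Formula p (1+ l) → Formula p l

module Semantics (𝔐 : PointLineStructure ℓ) where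
  open PointLineStructure 𝔐

  ⟦_⟧ : ∀ {p l} → Formula p l → Vec Point p → Vec Line l → Set ℓ
  ⟦ i ∈′ j ⟧ ps ls = lookup ps i ∈ lookup ls j
  ⟦ i ≡ᵖ j ⟧ ps ls = lookup ps i ≡ lookup ps j
  ⟦ i ≡ˡ j ⟧ ps ls = lookup ls i ≡ lookup ls j
  ⟦ ⊥′     ⟧ ps ls = ⊥
  ⟦ φ ∧′ ψ ⟧ ps ls = ⟦ φ ⟧ ps ls × ⟦ ψ ⟧ ps ls
  ⟦ φ ∨′ ψ ⟧ ps ls = ⟦ φ ⟧ ps ls ⊎ ⟦ ψ ⟧ ps ls
  ⟦ φ ⇒′ ψ ⟧ ps ls = ⟦ φ ⟧ ps ls → ⟦ ψ ⟧ ps ls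
  ⟦ ∀ᵖ φ   ⟧ ps ls = ∀ a → ⟦ φ ⟧ (a ∷ ps) ls
  ⟦ ∃ᵖ φ   ⟧ ps ls = ∃[ a ] ⟦ φ ⟧ (a ∷ ps) ls
  ⟦ ∀ˡ φ   ⟧ ps ls = ∀ L → ⟦ φ ⟧ ps (L ∷ ls)
  ⟦ ∃ˡ φ   ⟧ ps ls = ∃[ L ] ⟦ φ ⟧ ps (L ∷ ls)

-- Definability without parameters: the two free line variables are the only
-- ones.
Definable : (𝔐 : PointLineStructure ℓ) →
            let open PointLineStructure 𝔐 in
            (Line → Line → Set ℓ) → Set ℓ
Definable 𝔐 R =
  Σ[ φ ∈ Formula 0 2 ] (∀ L K → ⟦ φ ⟧ [] (L ∷ K ∷ []) ⇔ R L K)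
  where open Semantics 𝔐

{-# OPTIONS --safe #-}
module Submission where

-- Points of the Segre product are collinear iff they agree in a coordinate, so
-- incidence recognises when two lines lie in a common fiber, a copy of one of the
-- factors, and when one line is the translate of another into a parallel fiber.
-- Hence L ∥ K iff some translate of L lies in the fiber of K and is parallel to K
-- there.  Within an affine space all of whose lines have at least three points,
-- distinct lines are parallel iff they are disjoint and both crossed by two lines
-- through a common point outside them: a third point on a line joining them
-- yields the crossing lines by the Tamaschke condition, and conversely the same
-- condition makes coplanar disjoint lines parallel.  A factor with a two-point
-- line has at most four points, and there disjoint lines are parallel.  One
-- formula, symmetric in the factors, covers all cases.

open import Defs
open import Axiom.ExcludedMiddle using (ExcludedMiddle)
open import Relation.Nullary using (¬_)

open import Data.Empty using (⊥-elim)
open import Data.Fin using (Fin; suc)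
open import Data.Fin.Patterns using (0F; 1F; 2F)
open import Data.Nat using (ℕ)
open import Data.Product using (∃-syntax; _×_; _,_; proj₁; swap)
open import Data.Product.Function.Dependent.Propositional using (Σ-⇔)
open import Data.Product.Function.NonDependent.Propositional using (_×-⇔_)
open import Data.Sum as Sum using (_⊎_; inj₁; inj₂)
open import Data.Sum.Function.Propositional using (_⊎-⇔_)
open import Data.Vec using (Vec; []; _∷_; map)
open import Data.Vec.Properties using (lookup-map)
open import Data.Vec.Relation.Unary.All using ([]; _∷_)
open import Data.Vec.Relation.Unary.AllPairs using ([]; _∷_)
open import Data.Vec.Relation.Unary.Unique.Propositional using (Unique)
open import Data.Vec.Relation.Unary.Unique.Propositional.Properties using (lookup-injective)
open import Function.Base using (_∘_)
open import Function.Bundles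
  using (_⇔_; _↔_; mk⇔; mk↣; mk↔ₛ′; module Equivalence; module Inverse; module Injection)
open import Function.Construct.Composition using (_⇔-∘_)
open import Function.Properties.Inverse using (↔⇒↠; ↔⇒↣)
open import Function.Related.TypeIsomorphisms using (→-cong-⇔)
open import Level using (Level; lift; lower)
open import Relation.Binary.PropositionalEquality
  using (_≡_; _≢_; refl; sym; cong; subst; ≢-sym)
open import Relation.Binary.Structures using (IsEquivalence)
open import Relation.Nullary using (yes; no; contradiction)

private
  variable
    ℓ : Level
    p l : ℕ

-- The defining formula.

infix 30 ¬′_

¬′_ : Formula p l → Formula p l
¬′ φ = φ ⇒′ ⊥′

meet : Fin l → Fin l → Formula p l
meet i j = ∃ᵖ ((0F ∈′ i) ∧′ (0F ∈′ j))

collinear′ : Fin p → Fin p → Formula p l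
collinear′ a b = ∃ˡ ((a ∈′ 0F) ∧′ (b ∈′ 0F))

-- Unfolds under `⟦_⟧` to exactly the line clause of `BinaryOfDim≥3`.
twoPointLine : Fin l → Formula p l
twoPointLine i = ∃ᵖ (∃ᵖ (∀ᵖ ((0F ∈′ i) ⇒′ ((0F ≡ᵖ 2F) ∨′ (0F ≡ᵖ 1F)))))

transversals : Fin l → Fin l → Formula p l
transversals i j =
  ∃ᵖ (¬′ (0F ∈′ i) ∧′ (¬′ (0F ∈′ j) ∧′ ∃ˡ (∃ˡ (
    ¬′ (1F ≡ˡ 0F) ∧′
    (((0F ∈′ 1F) ∧′ (meet (suc (suc i)) 1F ∧′ meet (suc (suc j)) 1F)) ∧′
     ((0F ∈′ 0F) ∧′ (meet (suc (suc i)) 0F ∧′ meet (suc (suc j)) 0F)))))))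

-- The last disjunct serves the spaces of at most four points, where disjoint
-- lines are parallel but no line has a third point to carry a transversal.
parallelInFiber : Fin l → Fin l → Formula p l
parallelInFiber i j =
  (i ≡ˡ j) ∨′ (¬′ meet i j ∧′ (transversals i j ∨′ twoPointLine i))

-- Says of the lines a[i/l] and b[j/k] that i = j and that a and b agree in the
-- other coordinate.
sameFiber : Fin l → Fin l → Formula p l
sameFiber i j = ∀ᵖ (∀ᵖ ((1F ∈′ i) ⇒′ ((0F ∈′ j) ⇒′ collinear′ 1F 0F)))

eachPointCollinear : Fin l → Fin l → Formula p l
eachPointCollinear i j = ∀ᵖ ((0F ∈′ i) ⇒′ ∃ᵖ ((0F ∈′ j) ∧′ collinear′ 1F 0F))

-- Says of the lines a[i/l] and b[j/k] that i = j and l = k.  For disjoint lines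
-- with i ≠ j, every point of one can be collinear with a point of the other, but
-- not also conversely.
translate : Fin l → Fin l → Formula p l
translate i j =
  (i ≡ˡ j) ∨′
  (¬′ meet i j ∧′ (¬′ sameFiber i j ∧′
    (eachPointCollinear i j ∧′ eachPointCollinear j i)))

-- The bound line `0F` is the translate; it shifts the two free lines to `1F` and `2F`.
segreParallel : Formula 0 2
segreParallel =
  ∃ˡ (translate 1F 0F ∧′ (sameFiber 0F 2F ∧′ parallelInFiber 0F 2F))

-- Invariance of formulas under isomorphism.

module Isomorphism {𝔐 𝔑 : PointLineStructure ℓ} where
  private
    module M = PointLineStructure 𝔐
    module N = PointLineStructure 𝔑
    module SM = Semantics 𝔐
    module SN = Semantics 𝔑

  module _ (f : M.Point ↔ N.Point) (g : M.Line ↔ N.Line)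
           (∈-⇔ : ∀ a L → (a M.∈ L) ⇔ (Inverse.to f a N.∈ Inverse.to g L)) where
    private
      to-f = Inverse.to f
      to-g = Inverse.to g

    Π-⇔ : ∀ {A B : Set ℓ} {P : A → Set ℓ} {Q : B → Set ℓ} (h : A ↔ B) →
          (∀ a → P a ⇔ Q (Inverse.to h a)) → (∀ a → P a) ⇔ (∀ b → Q b)
    Π-⇔ {Q = Q} h P⇔Q = mk⇔
      (λ k b → subst Q (Inverse.strictlyInverseˡ h b)
                 (Equivalence.to (P⇔Q (Inverse.from h b)) (k (Inverse.from h b))))
      (λ k a → Equivalence.from (P⇔Q a) (k (Inverse.to h a)))

    ≡-⇔ : ∀ {A B : Set ℓ} (h : A ↔ B) {x y} → (x ≡ y) ⇔ (Inverse.to h x ≡ Inverse.to h y)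
    ≡-⇔ h = mk⇔ (cong (Inverse.to h)) (Injection.injective (↔⇒↣ h))

    ⟦⟧-⇔ : ∀ (φ : Formula p l) ps ls →
           SM.⟦ φ ⟧ ps ls ⇔ SN.⟦ φ ⟧ (map to-f ps) (map to-g ls)
    ⟦⟧-⇔ (i ∈′ j) ps ls rewrite lookup-map i to-f ps | lookup-map j to-g ls = ∈-⇔ _ _
    ⟦⟧-⇔ (i ≡ᵖ j) ps ls rewrite lookup-map i to-f ps | lookup-map j to-f ps = ≡-⇔ f
    ⟦⟧-⇔ (i ≡ˡ j) ps ls rewrite lookup-map i to-g ls | lookup-map j to-g ls = ≡-⇔ g
    ⟦⟧-⇔ ⊥′ ps ls = mk⇔ (λ ()) (λ ())
    ⟦⟧-⇔ (φ ∧′ ψ) ps ls = ⟦⟧-⇔ φ ps ls ×-⇔ ⟦⟧-⇔ ψ ps ls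
    ⟦⟧-⇔ (φ ∨′ ψ) ps ls = ⟦⟧-⇔ φ ps ls ⊎-⇔ ⟦⟧-⇔ ψ ps ls
    ⟦⟧-⇔ (φ ⇒′ ψ) ps ls = →-cong-⇔ (⟦⟧-⇔ φ ps ls) (⟦⟧-⇔ ψ ps ls)
    ⟦⟧-⇔ (∀ᵖ φ) ps ls = Π-⇔ f λ a → ⟦⟧-⇔ φ (a ∷ ps) ls
    ⟦⟧-⇔ (∃ᵖ φ) ps ls = Σ-⇔ (↔⇒↠ f) λ {a} → ⟦⟧-⇔ φ (a ∷ ps) ls
    ⟦⟧-⇔ (∀ˡ φ) ps ls = Π-⇔ g λ L → ⟦⟧-⇔ φ ps (L ∷ ls)
    ⟦⟧-⇔ (∃ˡ φ) ps ls = Σ-⇔ (↔⇒↠ g) λ {L} → ⟦⟧-⇔ φ ps (L ∷ ls)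

module PartialLinearSpace (em : ExcludedMiddle ℓ) {𝔐 : PointLineStructure ℓ}
                          (isPLS : IsPartialLinearSpace 𝔐) where
  open PointLineStructure 𝔐
  open IsPartialLinearSpace isPLS

  line-unique : ∀ {L K a b} → a ≢ b → a ∈ L → b ∈ L → a ∈ K → b ∈ K → L ≡ K
  line-unique {L} {K} a≢b a∈L b∈L a∈K b∈K with em {L ≡ K}
  ... | yes L≡K = L≡K
  ... | no  L≢K = contradiction (atMostOneInt L≢K a∈L a∈K b∈L b∈K) a≢b

  otherPoint : ∀ L a → ∃[ b ] b ∈ L × b ≢ a
  otherPoint L a with twoPoints L
  ... | u , v , u≢v , u∈L , v∈L with em {u ≡ a}
  ...   | yes refl = v , v∈L , ≢-sym u≢v
  ...   | no  u≢a  = u , u∈L , u≢a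

-- Parallelism within a single affine space.

module AffineSpace (em : ExcludedMiddle ℓ) {𝔄 : ParallelStructure ℓ}
                   (isAffine : IsAffineSpace 𝔄) (¬bin : ¬ BinaryOfDim≥3 𝔄) where
  open ParallelStructure 𝔄
  open IsAffineSpace isAffine
  open IsLinearSpace isLinearSpace using (isPartialLinearSpace; twoPoints; collinear)
  open IsAffinePartialLinear isAffinePartialLinear
    using (∥-meet⇒≡; parallelThrough; ∥-isEquivalence)
  open IsEquivalence ∥-isEquivalence
    using () renaming (sym to ∥-sym; reflexive to ∥-reflexive)
  open PartialLinearSpace em isPartialLinearSpace
  open Semantics reduct

  TwoPoint : Line → Set ℓ
  TwoPoint L = ∃[ a ] ∃[ b ] (∀ c → c ∈ L → c ≡ a ⊎ c ≡ b)

  thirdPoint : ∀ {L} → ¬ TwoPoint L → ∀ a b → ∃[ c ] c ∈ L × c ≢ a × c ≢ b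
  thirdPoint {L} ¬two a b with em {∃[ c ] c ∈ L × c ≢ a × c ≢ b}
  ... | yes c = c
  ... | no ¬c = ⊥-elim (¬two (a , b , covered))
    where
    covered : ∀ c → c ∈ L → c ≡ a ⊎ c ≡ b
    covered c c∈L with em {c ≡ a} | em {c ≡ b}
    ... | yes c≡a | _       = inj₁ c≡a
    ... | no  _   | yes c≡b = inj₂ c≡b
    ... | no  c≢a | no  c≢b = ⊥-elim (¬c (c , c∈L , c≢a , c≢b))

  -- Five distinct points beside a two-point line are the excluded case `BinaryOfDim≥3`, so a
  -- two-point line is refuted below by listing five points.
  twoPoint⇒¬fivePoints : ∀ {L} → TwoPoint L → {xs : Vec Point 5} → ¬ Unique xs
  twoPoint⇒¬fivePoints {L} (a , b , ab) {xs} uniq =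
    ¬bin ((L , a , b , ab) , mk↣ (λ {i} {j} → lookup-injective uniq i j))

  ∥-off : ∀ {L K a} → L ∥ K → a ∈ L → L ≢ K → ¬ a ∈ K
  ∥-off L∥K a∈L L≢K a∈K = L≢K (∥-meet⇒≡ L∥K (_ , a∈L , a∈K))

  off⇒≢ : ∀ {L a b} → a ∈ L → ¬ b ∈ L → a ≢ b
  off⇒≢ a∈L b∉L refl = b∉L a∈L

  -- The parallel `N` to `L` through `c` must be `K`: otherwise the Tamaschke condition, used at `p`
  -- and then at `d`, makes `L` meet `K`.
  transversals⇒∥ : ∀ {L K} → ¬ Meet L K →
    ⟦ transversals 0F 1F ⟧ [] (L ∷ K ∷ []) → L ∥ K
  transversals⇒∥ {L} {K} L∩K=∅
    (p , p∉L , p∉K , L₁ , L₂ , L₁≢L₂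
      , (p∈L₁ , LL₁@(a , a∈L , a∈L₁) , (c , c∈K , c∈L₁))
      , (p∈L₂ , LL₂ , (d , d∈K , d∈L₂)))
    with parallelThrough c L
  ... | N , c∈N , N∥L with em {N ≡ K}
  ...   | yes refl = ∥-sym N∥L
  -- At the vertex `d` of `L₂` and `K`, the line `N` meets both and its parallel `L` meets `L₂`, so
  -- `L` would meet `K`.
  ...   | no  N≢K  = ⊥-elim (L∩K=∅ (tamaschke d∈L₂ d∈K d∉N d∉L NL₂ (c , c∈N , c∈K) LL₂ N∥L))
    where
    c≢p : c ≢ p
    c≢p refl = lower (p∉K c∈K)
    p∉N : ¬ p ∈ N
    p∉N p∈N with line-unique c≢p c∈L₁ p∈L₁ c∈N p∈N
    ... | refl with ∥-meet⇒≡ N∥L (a , a∈L₁ , a∈L)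
    ...   | refl = lower (p∉L p∈N)
    NL₂ : Meet N L₂
    NL₂ = tamaschke p∈L₁ p∈L₂ (lower ∘ p∉L) p∉N LL₁ LL₂ (c , c∈N , c∈L₁) (∥-sym N∥L)
    c≢d : c ≢ d
    c≢d refl = lower (L₁≢L₂ (line-unique c≢p c∈L₁ p∈L₁ d∈L₂ p∈L₂))
    d∉N : ¬ d ∈ N
    d∉N d∈N = N≢K (line-unique c≢d c∈N d∈N c∈K d∈K)
    d∉L : ¬ d ∈ L
    d∉L d∈L = L∩K=∅ (d , d∈L , d∈K)

  -- If the parallel `N` to `K` through `a` leaves `L`, a further point `m` of `N` is a fifth point
  -- besides two on `L` and two on `K`.
  twoPoint⇒∥ : ∀ {L K} → ¬ Meet L K → TwoPoint L → L ∥ K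
  twoPoint⇒∥ {L} {K} L∩K=∅ two
    with twoPoints L | twoPoints K
  ... | a , a′ , a≢a′ , a∈L , a′∈L | k , k′ , k≢k′ , k∈K , k′∈K
    with parallelThrough a K
  ... | N , a∈N , N∥K with otherPoint N a
  ... | m , m∈N , m≢a with em {m ∈ L}
  ... | yes m∈L = subst (_∥ K) (line-unique m≢a m∈N a∈N m∈L a∈L) N∥K
  ... | no  m∉L = ⊥-elim (twoPoint⇒¬fivePoints two
      ((a≢a′ ∷ off a∈L k∈K ∷ off a∈L k′∈K ∷ off⇒≢ a∈L m∉L ∷ []) ∷
       (off a′∈L k∈K ∷ off a′∈L k′∈K ∷ off⇒≢ a′∈L m∉L ∷ []) ∷
       (k≢k′ ∷ off⇒≢ k∈K m∉K ∷ []) ∷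
       (off⇒≢ k′∈K m∉K ∷ []) ∷ [] ∷ []))
    where
    off : ∀ {x y} → x ∈ L → y ∈ K → x ≢ y
    off x∈L y∈K refl = L∩K=∅ (_ , x∈L , y∈K)
    m∉K : ¬ m ∈ K
    m∉K = ∥-off N∥K m∈N (λ { refl → L∩K=∅ (a , a∈L , a∈N) })

  -- A third point `p` of a line `M` joining `L` to `K` lies off both. Any line joining `p` to
  -- another point of `L` then meets `K` by the Tamaschke condition.
  ∥⇒transversals : ∀ {L K} → L ∥ K → L ≢ K → ¬ TwoPoint L →
    ⟦ transversals 0F 1F ⟧ [] (L ∷ K ∷ [])
  ∥⇒transversals {L} {K} L∥K L≢K ¬two
    with twoPoints L | twoPoints K
  ... | a , b , a≢b , a∈L , b∈L | k , k′ , k≢k′ , k∈K , k′∈K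
    with thirdPoint ¬two a b | collinear a k
  ... | c , c∈L , c≢a , c≢b | M , a∈M , k∈M
    with thirdPoint ¬twoM a k
    where
    off : ∀ {x y} → x ∈ L → y ∈ K → x ≢ y
    off x∈L y∈K refl = ∥-off L∥K x∈L L≢K y∈K
    ¬twoM : ¬ TwoPoint M
    -- Three points of `L` and two of `K` are five, so `M` has a third point as well.
    ¬twoM twoM = twoPoint⇒¬fivePoints twoM
      ((a≢b ∷ ≢-sym c≢a ∷ off a∈L k∈K ∷ off a∈L k′∈K ∷ []) ∷
       (≢-sym c≢b ∷ off b∈L k∈K ∷ off b∈L k′∈K ∷ []) ∷
       (off c∈L k∈K ∷ off c∈L k′∈K ∷ []) ∷
       (k≢k′ ∷ []) ∷ [] ∷ [])
  ... | p , p∈M , p≢a , p≢k with collinear p b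
  ... | M₂ , p∈M₂ , b∈M₂ =
    p , lift ∘ p∉L , lift ∘ p∉K , M , M₂ , lift ∘ M≢M₂
      , (p∈M , LM , KM)
      , (p∈M₂ , LM₂ , tamaschke p∈M p∈M₂ p∉L p∉K LM LM₂ KM L∥K)
    where
    LM : Meet L M
    LM = a , a∈L , a∈M
    KM : Meet K M
    KM = k , k∈K , k∈M
    LM₂ : Meet L M₂
    LM₂ = b , b∈L , b∈M₂
    p∉L : ¬ p ∈ L
    p∉L p∈L with line-unique p≢a p∈M a∈M p∈L a∈L
    ... | refl = ∥-off L∥K k∈M L≢K k∈K
    p∉K : ¬ p ∈ K
    p∉K p∈K with line-unique p≢k p∈M k∈M p∈K k∈K
    ... | refl = ∥-off L∥K a∈L L≢K a∈M
    M≢M₂ : M ≢ M₂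
    M≢M₂ refl with line-unique a≢b a∈L b∈L a∈M b∈M₂
    ... | refl = p∉L p∈M

  parallelInFiber-⇔ : ∀ {L K} →
    ⟦ parallelInFiber 0F 1F ⟧ [] (L ∷ K ∷ []) ⇔ (L ∥ K)
  parallelInFiber-⇔ {L} {K} = mk⇔ to from
    where
    to : ⟦ parallelInFiber 0F 1F ⟧ [] (L ∷ K ∷ []) → L ∥ K
    to (inj₁ L≡K)               = ∥-reflexive L≡K
    to (inj₂ (L∩K=∅ , inj₁ ts)) = transversals⇒∥ (lower ∘ L∩K=∅) ts
    to (inj₂ (L∩K=∅ , inj₂ tp)) = twoPoint⇒∥ (lower ∘ L∩K=∅) tp

    from : L ∥ K → ⟦ parallelInFiber 0F 1F ⟧ [] (L ∷ K ∷ [])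
    from L∥K with em {L ≡ K} | em {TwoPoint L}
    ... | yes L≡K | _       = inj₁ L≡K
    ... | no  L≢K | yes two = inj₂ (lift ∘ L≢K ∘ ∥-meet⇒≡ L∥K , inj₂ two)
    ... | no  L≢K | no ¬two = inj₂ (lift ∘ L≢K ∘ ∥-meet⇒≡ L∥K , inj₁ (∥⇒transversals L∥K L≢K ¬two))

-- Fibers and translates in the Segre product.

module SegreProduct (em : ExcludedMiddle ℓ) {𝔐₁ 𝔐₂ : PointLineStructure ℓ}
                    (isLin₁ : IsLinearSpace 𝔐₁) (isLin₂ : IsLinearSpace 𝔐₂) where
  private
    module M₁ = PointLineStructure 𝔐₁
    module M₂ = PointLineStructure 𝔐₂
    module L₁ = IsLinearSpace isLin₁
    module L₂ = IsLinearSpace isLin₂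
    module P₁ = PartialLinearSpace em L₁.isPartialLinearSpace
    module P₂ = PartialLinearSpace em L₂.isPartialLinearSpace
    module S₁ = Semantics 𝔐₁
    module S  = Semantics (𝔐₁ ⊗ 𝔐₂)
  open PointLineStructure (𝔐₁ ⊗ 𝔐₂)

  collinear⇒ : ∀ {x y x′ y′} → Collinear (x , y) (x′ , y′) → x ≡ x′ ⊎ y ≡ y′
  collinear⇒ (line₁ _ _ , (_ , refl) , (_ , refl)) = inj₂ refl
  collinear⇒ (line₂ _ _ , (refl , _) , (refl , _)) = inj₁ refl

  collinear₁ : ∀ x x′ y → Collinear (x , y) (x′ , y)
  collinear₁ x x′ y with L₁.collinear x x′
  ... | l , x∈l , x′∈l = line₁ l y , (x∈l , refl) , (x′∈l , refl)

  collinear₂ : ∀ x y y′ → Collinear (x , y) (x , y′)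
  collinear₂ x y y′ with L₂.collinear y y′
  ... | l , y∈l , y′∈l = line₂ x l , (refl , y∈l) , (refl , y′∈l)

  -- Lines have two points, so a pair of points can be chosen that differ in the first coordinate;
  -- collinearity then forces equal second coordinates. On a line of the other kind both coordinates
  -- can be made to differ.
  sameFiber⇒ : ∀ {l y K} → S.⟦ sameFiber 0F 1F ⟧ [] (line₁ l y ∷ K ∷ []) →
               ∃[ k ] K ≡ line₁ k y
  sameFiber⇒ {l} {y} {line₁ k z} sf with L₁.twoPoints k
  ... | w , _ , _ , w∈k , _ with P₁.otherPoint l w
  ... | u , u∈l , u≢w with collinear⇒ (sf (u , y) (w , z) (u∈l , refl) (w∈k , refl))
  ...   | inj₁ u≡w  = contradiction u≡w u≢w
  ...   | inj₂ refl = k , refl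
  sameFiber⇒ {l} {y} {line₂ x k} sf with P₁.otherPoint l x | P₂.otherPoint k y
  ... | u , u∈l , u≢x | q , q∈k , q≢y
    with collinear⇒ (sf (u , y) (x , q) (u∈l , refl) (refl , q∈k))
  ...   | inj₁ u≡x = contradiction u≡x u≢x
  ...   | inj₂ y≡q = contradiction (sym y≡q) q≢y

  sameFiber⇐ : ∀ l k y → S.⟦ sameFiber 0F 1F ⟧ [] (line₁ l y ∷ line₁ k y ∷ [])
  sameFiber⇐ l k y (u , _) (v , _) (_ , refl) (_ , refl) = collinear₁ u v y

  translate⇒ : ∀ {l y K} → S.⟦ translate 0F 1F ⟧ [] (line₁ l y ∷ K ∷ []) →
               ∃[ z ] K ≡ line₁ l z
  translate⇒ (inj₁ refl) = _ , refl
  translate⇒ {l} {y} {line₁ k z} (inj₂ (_ , ¬sf , eachL , _)) with em {y ≡ z}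
  ... | yes refl = ⊥-elim (lower (¬sf (sameFiber⇐ l k y)))
  -- Across distinct fibers collinear points share their first coordinate, so `l` is contained in
  -- `k`.
  ... | no  y≢z  = z , sym (cong (λ m → line₁ m z) l≡k)
    where
    l⊆k : ∀ {x} → x M₁.∈ l → x M₁.∈ k
    l⊆k {x} x∈l with eachL (x , y) (x∈l , refl)
    ... | _ , (x′∈k , refl) , col with collinear⇒ col
    ...   | inj₁ refl = x′∈k
    ...   | inj₂ y≡z  = contradiction y≡z y≢z
    l≡k : l ≡ k
    l≡k with L₁.twoPoints l
    ... | a , b , a≢b , a∈l , b∈l = P₁.line-unique a≢b a∈l b∈l (l⊆k a∈l) (l⊆k b∈l)
  -- Lines of different kinds can meet only in `(x , y)`. Collinearity from `line₁ l y` puts `y` on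
  -- `k`, and collinearity from `line₂ x k` puts `x` on `l`.
  translate⇒ {l} {y} {line₂ x k} (inj₂ (disj , _ , eachL , eachK)) =
    ⊥-elim (lower (disj ((x , y) , (x∈l , refl) , (refl , y∈k))))
    where
    y∈k : y M₂.∈ k
    y∈k with P₁.otherPoint l x
    ... | u , u∈l , u≢x with eachL (u , y) (u∈l , refl)
    ...   | _ , (refl , q∈k) , col with collinear⇒ col
    ...     | inj₁ u≡x  = contradiction u≡x u≢x
    ...     | inj₂ refl = q∈k
    x∈l : x M₁.∈ l
    x∈l with P₂.otherPoint k y
    ... | q , q∈k , q≢y with eachK (x , q) (refl , q∈k)
    ...   | _ , (u∈l , refl) , col with collinear⇒ col
    ...     | inj₁ refl = u∈l
    ...     | inj₂ q≡y  = contradiction q≡y q≢y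

  translate⇐ : ∀ l y z → S.⟦ translate 0F 1F ⟧ [] (line₁ l y ∷ line₁ l z ∷ [])
  translate⇐ l y z with em {y ≡ z}
  ... | yes refl = inj₁ refl
  ... | no  y≢z  = inj₂
    ( (λ { ((_ , _) , (_ , refl) , (_ , y≡z)) → contradiction y≡z y≢z })
    , ¬sameFiber
    , (λ { (x , _) (x∈l , refl) → (x , z) , (x∈l , refl) , collinear₂ x y z })
    , (λ { (x , _) (x∈l , refl) → (x , y) , (x∈l , refl) , collinear₂ x z y }))
    where
    ¬sameFiber : S.⟦ ¬′ sameFiber 0F 1F ⟧ [] (line₁ l y ∷ line₁ l z ∷ [])
    ¬sameFiber sf with sameFiber⇒ {l} {y} {line₁ l z} sf
    ... | _ , refl = contradiction refl y≢z

  fiber-meet⇔ : ∀ {l k y} → Meet (line₁ l y) (line₁ k y) ⇔ M₁.Meet l k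
  fiber-meet⇔ {y = y} = mk⇔
    (λ { ((x , _) , (x∈l , _) , (x∈k , _)) → x , x∈l , x∈k })
    (λ { (x , x∈l , x∈k) → (x , y) , (x∈l , refl) , (x∈k , refl) })

  -- A line of the other kind has only one point in the fiber, which would be common to the two
  -- disjoint lines.
  crossing-fiber : ∀ {l k y N} → ¬ Meet (line₁ l y) (line₁ k y) →
    Meet (line₁ l y) N → Meet (line₁ k y) N → ∃[ n ] N ≡ line₁ n y
  crossing-fiber {N = line₁ n _} _ (_ , (_ , refl) , (_ , refl)) _ = n , refl
  crossing-fiber {N = line₂ x n} disj (_ , lx@(_ , refl) , (refl , _))
                                     (_ , kx@(_ , refl) , (refl , _)) =
    ⊥-elim (disj (_ , lx , kx))

  -- The formula quantifies over the whole product, but `crossing-fiber` confines the crossing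
  -- lines, and hence `p`, to the fiber.
  fiber-transversals⇒ : ∀ {l k y} → ¬ Meet (line₁ l y) (line₁ k y) →
    S.⟦ transversals 0F 1F ⟧ [] (line₁ l y ∷ line₁ k y ∷ []) →
    S₁.⟦ transversals 0F 1F ⟧ [] (l ∷ k ∷ [])
  fiber-transversals⇒ disj
    ((p , _) , p∉l , p∉k , N , N′ , N≢N′ , (p∈N , lN , kN) , (p∈N′ , lN′ , kN′))
    with crossing-fiber disj lN kN | crossing-fiber disj lN′ kN′
  fiber-transversals⇒ disj
    ((p , _) , p∉l , p∉k , _ , _ , N≢N′ , ((p∈n , refl) , lN , kN) , ((p∈n′ , _) , lN′ , kN′))
    | n , refl | n′ , refl =
    p , (λ p∈l → p∉l (p∈l , refl)) , (λ p∈k → p∉k (p∈k , refl)) , n , n′ ,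
    (λ { refl → N≢N′ refl }) ,
    (p∈n , to lN , to kN) , (p∈n′ , to lN′ , to kN′)
    where
    to : ∀ {l k y} → Meet (line₁ l y) (line₁ k y) → M₁.Meet l k
    to = Equivalence.to fiber-meet⇔

  fiber-transversals⇐ : ∀ {l k y} →
    S₁.⟦ transversals 0F 1F ⟧ [] (l ∷ k ∷ []) →
    S.⟦ transversals 0F 1F ⟧ [] (line₁ l y ∷ line₁ k y ∷ [])
  fiber-transversals⇐ {y = y}
    (p , p∉l , p∉k , n , n′ , n≢n′ , (p∈n , ln , kn) , (p∈n′ , ln′ , kn′)) =
    (p , y) , p∉l ∘ proj₁ , p∉k ∘ proj₁ , line₁ n y , line₁ n′ y ,
    (λ { refl → n≢n′ refl }) ,
    ((p∈n , refl) , from ln , from kn) , ((p∈n′ , refl) , from ln′ , from kn′)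
    where
    from : ∀ {l k} → M₁.Meet l k → Meet (line₁ l y) (line₁ k y)
    from = Equivalence.from fiber-meet⇔

  fiber-twoPoint⇔ : ∀ {l y} →
    S.⟦ twoPointLine 0F ⟧ [] (line₁ l y ∷ []) ⇔ S₁.⟦ twoPointLine 0F ⟧ [] (l ∷ [])
  fiber-twoPoint⇔ {l} {y} = mk⇔ to from
    where
    to : S.⟦ twoPointLine 0F ⟧ [] (line₁ l y ∷ []) → S₁.⟦ twoPointLine 0F ⟧ [] (l ∷ [])
    to ((a , _) , (b , _) , ab) =
      a , b , λ c c∈l → Sum.map (cong proj₁) (cong proj₁) (ab (c , y) (c∈l , refl))
    from : S₁.⟦ twoPointLine 0F ⟧ [] (l ∷ []) → S.⟦ twoPointLine 0F ⟧ [] (line₁ l y ∷ [])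
    from (a , b , ab) =
      (a , y) , (b , y) ,
      λ { (c , _) (c∈l , refl) → Sum.map (cong (_, y)) (cong (_, y)) (ab c c∈l) }

  fiber-parallel⇔ : ∀ {l k y} →
    S.⟦ parallelInFiber 0F 1F ⟧ [] (line₁ l y ∷ line₁ k y ∷ []) ⇔
    S₁.⟦ parallelInFiber 0F 1F ⟧ [] (l ∷ k ∷ [])
  fiber-parallel⇔ {l} {k} {y} = mk⇔ to from
    where
    to : S.⟦ parallelInFiber 0F 1F ⟧ [] (line₁ l y ∷ line₁ k y ∷ []) →
         S₁.⟦ parallelInFiber 0F 1F ⟧ [] (l ∷ k ∷ [])
    to (inj₁ refl) = inj₁ refl
    to (inj₂ (disj , inj₁ ts)) =
      inj₂ (disj ∘ Equivalence.from fiber-meet⇔ , inj₁ (fiber-transversals⇒ (lower ∘ disj) ts))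
    to (inj₂ (disj , inj₂ tp)) =
      inj₂ (disj ∘ Equivalence.from fiber-meet⇔ , inj₂ (Equivalence.to fiber-twoPoint⇔ tp))
    from : S₁.⟦ parallelInFiber 0F 1F ⟧ [] (l ∷ k ∷ []) →
           S.⟦ parallelInFiber 0F 1F ⟧ [] (line₁ l y ∷ line₁ k y ∷ [])
    from (inj₁ refl) = inj₁ refl
    from (inj₂ (disj , inj₁ ts)) =
      inj₂ (disj ∘ Equivalence.to fiber-meet⇔ , inj₁ (fiber-transversals⇐ ts))
    from (inj₂ (disj , inj₂ tp)) =
      inj₂ (disj ∘ Equivalence.to fiber-meet⇔ , inj₂ (Equivalence.from fiber-twoPoint⇔ tp))

-- Lines of the first kind, and the symmetry of the factors.

segreParallel-line₁ : ExcludedMiddle ℓ → (𝔄₁ 𝔄₂ : ParallelStructure ℓ) →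
  IsAffineSpace 𝔄₁ → IsAffineSpace 𝔄₂ → ¬ BinaryOfDim≥3 𝔄₁ →
  let 𝔐 = ParallelStructure.reduct 𝔄₁ ⊗ ParallelStructure.reduct 𝔄₂ in
  ∀ l y K → Semantics.⟦_⟧ 𝔐 segreParallel [] (line₁ l y ∷ K ∷ []) ⇔
            SegreParallel 𝔄₁ 𝔄₂ (line₁ l y) K
segreParallel-line₁ em 𝔄₁ 𝔄₂ aff₁ aff₂ ¬bin₁ l y K = mk⇔ to (from K)
  where
  𝔐 = ParallelStructure.reduct 𝔄₁ ⊗ ParallelStructure.reduct 𝔄₂
  open Semantics 𝔐
  open SegreProduct em (IsAffineSpace.isLinearSpace aff₁) (IsAffineSpace.isLinearSpace aff₂)
  open AffineSpace em aff₁ ¬bin₁ using (parallelInFiber-⇔)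

  to : ⟦ segreParallel ⟧ [] (line₁ l y ∷ K ∷ []) → SegreParallel 𝔄₁ 𝔄₂ (line₁ l y) K
  to (M , tr , sf , par) with translate⇒ {l} {y} {M} tr
  ... | z , refl with sameFiber⇒ {l} {z} {K} sf
  ...   | k , refl = Equivalence.to parallelInFiber-⇔ (Equivalence.to fiber-parallel⇔ par)

  from : ∀ K → SegreParallel 𝔄₁ 𝔄₂ (line₁ l y) K → ⟦ segreParallel ⟧ [] (line₁ l y ∷ K ∷ [])
  from (line₁ k z) l∥k =
    -- The witness is the translate of the first line into the fiber of `K`.
    line₁ l z , translate⇐ l y z , sameFiber⇐ l k z ,
    Equivalence.from fiber-parallel⇔ (Equivalence.from parallelInFiber-⇔ l∥k)
  from (line₂ _ _) ()

swapLine : ∀ (𝔐₁ 𝔐₂ : PointLineStructure ℓ) → SegreLine 𝔐₁ 𝔐₂ → SegreLine 𝔐₂ 𝔐₁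
swapLine _ _ (line₁ l b) = line₂ b l
swapLine _ _ (line₂ a l) = line₁ l a

swapLine-involutive : ∀ (𝔐₁ 𝔐₂ : PointLineStructure ℓ) L →
                      swapLine 𝔐₁ 𝔐₂ (swapLine 𝔐₂ 𝔐₁ L) ≡ L
swapLine-involutive _ _ (line₁ _ _) = refl
swapLine-involutive _ _ (line₂ _ _) = refl

-- Exchanging coordinates is an isomorphism of the two products, which reduces lines of the second
-- kind to the first.
⟦⟧-swap : ∀ (𝔐₁ 𝔐₂ : PointLineStructure ℓ) (φ : Formula 0 l) ls →
          Semantics.⟦_⟧ (𝔐₁ ⊗ 𝔐₂) φ [] ls ⇔
          Semantics.⟦_⟧ (𝔐₂ ⊗ 𝔐₁) φ [] (map (swapLine 𝔐₁ 𝔐₂) ls)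
⟦⟧-swap 𝔐₁ 𝔐₂ φ ls = Isomorphism.⟦⟧-⇔
  (mk↔ₛ′ swap swap (λ _ → refl) (λ _ → refl))
  (mk↔ₛ′ (swapLine 𝔐₁ 𝔐₂) (swapLine 𝔐₂ 𝔐₁)
         (swapLine-involutive 𝔐₁ 𝔐₂) (swapLine-involutive 𝔐₂ 𝔐₁))
  (λ { _ (line₁ _ _) → mk⇔ swap swap ; _ (line₂ _ _) → mk⇔ swap swap })
  φ [] ls

SegreParallel-swap : ∀ (𝔄₁ 𝔄₂ : ParallelStructure ℓ) x l K →
  let swapL = swapLine (ParallelStructure.reduct 𝔄₁) (ParallelStructure.reduct 𝔄₂) in
  SegreParallel 𝔄₂ 𝔄₁ (line₁ l x) (swapL K) ⇔ SegreParallel 𝔄₁ 𝔄₂ (line₂ x l) K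
SegreParallel-swap 𝔄₁ 𝔄₂ x l (line₁ _ _) = mk⇔ (λ ()) (λ ())
SegreParallel-swap 𝔄₁ 𝔄₂ x l (line₂ _ _) = mk⇔ (λ l∥k → l∥k) (λ l∥k → l∥k)

theorem3p13 : ∀ {ℓ} → ExcludedMiddle ℓ →
    (𝔄₁ 𝔄₂ : ParallelStructure ℓ) →
    IsAffineSpace 𝔄₁ → IsAffineSpace 𝔄₂ →
    ¬ BinaryOfDim≥3 𝔄₁ → ¬ BinaryOfDim≥3 𝔄₂ →
    Definable (ParallelStructure.reduct 𝔄₁ ⊗ ParallelStructure.reduct 𝔄₂)
    (SegreParallel 𝔄₁ 𝔄₂)
theorem3p13 em 𝔄₁ 𝔄₂ aff₁ aff₂ ¬bin₁ ¬bin₂ = segreParallel , defines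
  where
  𝔐₁ = ParallelStructure.reduct 𝔄₁
  𝔐₂ = ParallelStructure.reduct 𝔄₂
  open Semantics (𝔐₁ ⊗ 𝔐₂)

  defines : ∀ L K → ⟦ segreParallel ⟧ [] (L ∷ K ∷ []) ⇔ SegreParallel 𝔄₁ 𝔄₂ L K
  defines (line₁ l y) K = segreParallel-line₁ em 𝔄₁ 𝔄₂ aff₁ aff₂ ¬bin₁ l y K
  defines (line₂ x l) K =
    -- Read from the bottom: exchange the factors, apply the case of the first kind, and carry
    -- parallelism back.
    SegreParallel-swap 𝔄₁ 𝔄₂ x l K
      ⇔-∘ (segreParallel-line₁ em 𝔄₂ 𝔄₁ aff₂ aff₁ ¬bin₂ l x (swapLine 𝔐₁ 𝔐₂ K)
      ⇔-∘ ⟦⟧-swap 𝔐₁ 𝔐₂ segreParallel (line₂ x l ∷ K ∷ []))
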